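{- There exist planar graphs that are not $(4,2)$-correspondence choosable.
   Context: Graphs are finite and simple. An $\ell$-list assignment $L$ for a graph $G$ is a function that assigns to each vertex $v\in V(G)$ a list (set) $L(v)$ of at least $\ell$ colours. A correspondence assignment $(L,M)$ for $G$ is a list assignment $L$ together with a function $M$ that assigns to every edge $e=uv\in E(G)$ a partial matching $M_e$ between $\{u\}\times L(u)$ and $\{v\}\times L(v)$. An $(L,M)$-colouring of $G$ is a function $\varphi$ that assigns to each vertex $v\in V(G)$ a colour $\varphi(v)\in L(v)$ such that for every $e=uv\in E(G)$ we have $(u,\varphi(u))(v,\varphi(v))\notin M_e$ (that is, $(u,\varphi(u))$ and $(v,\varphi(v))$ are not matched to each other by $M_e$). $G$ is $(L,M)$-colourable if such a colouring exists. For positive integers $\ell,k$, a correspondence assignment $(L,M)$ for $G$ is an $(\ell,k)$-correspondence assignment if $L$ is an $\ell$-list assignment and $|M_e|\leq k$ for every edge $e\in E(G)$. $G$ is $(\ell,k)$-correspondence choosable if $G$ is $(L,M)$-colourable for every $(\ell,k)$-correspondence assignment $(L,M)$ for $G$. -}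

module Defs where

open import Data.Nat using (ℕ; _≤_)
open import Data.Fin as Fin using (Fin)
open import Data.List using (List; []; _∷_; length; map)
open import Data.List.Membership.Propositional using (_∈_; _∉_)
open import Data.List.Relation.Unary.All using (All)
open import Data.List.Relation.Unary.Unique.Propositional using (Unique)
open import Data.Product using (_×_; _,_; proj₁; proj₂; ∃; ∃-syntax)
open import Data.Rational as ℚ using (ℚ; 0ℚ; 1ℚ)
open import Data.Sum using (_⊎_)
open import Function.Definitions using (Injective)
open import Relation.Binary.PropositionalEquality using (_≡_; _≢_)
open import Relation.Nullary using (¬_)

-- The vertices are Fin order and the edges Fin size.  Listing the two ends of
-- an edge in increasing order excludes loops and gives each unordered pair a
-- single representation, so injectivity of ends excludes parallel edges.
record Graph : Set where
  field
    order          : ℕ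
    size           : ℕ
    ends           : Fin size → Fin order × Fin order
    ends-ordered   : ∀ e → proj₁ (ends e) Fin.< proj₂ (ends e)
    ends-injective : Injective _≡_ _≡_ ends

  Vertex : Set
  Vertex = Fin order

  Edge : Set
  Edge = Fin size

  src tgt : Edge → Vertex
  src e = proj₁ (ends e)
  tgt e = proj₂ (ends e)

-- Planarity: drawings whose edges are simple polygonal arcs with rational
-- corners.  Two segments with rational endpoints that share a real point also
-- share a rational one, so testing intersections on rational points loses
-- nothing compared with the real plane.
Point : Set
Point = ℚ × ℚ

OnSegment : Point → Point → Point → Set
OnSegment (px , py) (ax , ay) (bx , by) =
  ∃[ t ] (0ℚ ℚ.≤ t × t ℚ.≤ 1ℚ
          × px ≡ ax ℚ.+ t ℚ.* (bx ℚ.- ax)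
          × py ≡ ay ℚ.+ t ℚ.* (by ℚ.- ay))

-- OnArc p a cs b: p lies on the polygonal line from a through the successive
-- corners cs to b.
OnArc : Point → Point → List Point → Point → Set
OnArc p a []       b = OnSegment p a b
OnArc p a (c ∷ cs) b = OnSegment p a c ⊎ OnArc p c cs b

-- No segment is degenerate, and each one meets the remainder of the line only
-- in the corner where that remainder starts; the line is then homeomorphic to
-- a closed interval.
SimpleArc : Point → List Point → Point → Set
SimpleArc a []       b = a ≢ b
SimpleArc a (c ∷ cs) b =
  a ≢ c
  × (∀ p → OnSegment p a c → OnArc p c cs b → p ≡ c)
  × SimpleArc c cs b

record PlaneDrawing (G : Graph) : Set where
  open Graph G
  field
    position           : Vertex → Point
    position-injective : Injective _≡_ _≡_ position
    corners            : Edge → List Point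

  On : Point → Edge → Set
  On p e = OnArc p (position (src e)) (corners e) (position (tgt e))

  Interior : Point → Edge → Set
  Interior p e = On p e × p ≢ position (src e) × p ≢ position (tgt e)

  field
    arcs-simple     : ∀ e → SimpleArc (position (src e)) (corners e) (position (tgt e))
    avoids-vertices : ∀ e v p → Interior p e → p ≢ position v
    avoids-edges    : ∀ e f p → e ≢ f → Interior p e → ¬ On p f

Planar : Graph → Set
Planar G = PlaneDrawing G

Colour : Set
Colour = ℕ

record CorrespondenceAssignment (G : Graph) : Set where
  open Graph G
  field
    L        : Vertex → List Colour
    L-unique : ∀ v → Unique (L v)
    -- (c , d) ∈ M e stands for the pair (src e , c)(tgt e , d).
    M        : Edge → List (Colour × Colour)
    M-lists  : ∀ e → All (λ (c , d) → c ∈ L (src e) × d ∈ L (tgt e)) (M e)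
    -- M e is a partial matching: no colour on either side is used twice.
    -- In particular M e has no repetitions, so its length is its cardinality.
    M-uniqueˡ : ∀ e → Unique (map proj₁ (M e))
    M-uniqueʳ : ∀ e → Unique (map proj₂ (M e))

module _ {G : Graph} where
  open Graph G

  Is⟨_,_⟩-Assignment : ℕ → ℕ → CorrespondenceAssignment G → Set
  Is⟨ ℓ , k ⟩-Assignment A =
    (∀ v → ℓ ≤ length (L v)) × (∀ e → length (M e) ≤ k)
    where open CorrespondenceAssignment A

  IsColouring : CorrespondenceAssignment G → (Vertex → Colour) → Set
  IsColouring A φ =
    (∀ v → φ v ∈ L v) × (∀ e → (φ (src e) , φ (tgt e)) ∉ M e)
    where open CorrespondenceAssignment A

  Colourable : CorrespondenceAssignment G → Set
  Colourable A = ∃ (IsColouring A)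

CorrespondenceChoosable : ℕ → ℕ → Graph → Set
CorrespondenceChoosable ℓ k G =
  (A : CorrespondenceAssignment G) → Is⟨ ℓ , k ⟩-Assignment A → Colourable A

{-# OPTIONS --safe #-}
module Submission where

-- Suppose that two poles u, v have colours a, b, and let w₁, w₂ be adjacent to
-- each other and to both poles.  The poles can exclude colours 0 and 1 at w₁ and
-- w₂, and the edge w₁w₂ can exclude the pairs (2 , 2) and (3 , 3).  Each of the
-- pairs (2 , 3) and (3 , 2) is excluded by an octahedron drawn in one of the
-- triangles u w₁ w₂ and v w₁ w₂: the colours of the outer triangle leave only 2
-- and 3 at each of the three inner vertices x, y, z, and the edges of the
-- triangle x y z exclude equal colours.  Sixteen copies of this gadget at the
-- same two poles, one for each (a , b), leave no colouring.

open import Defs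
open import Data.Empty using (⊥)
open import Data.Fin as Fin using (Fin; zero; suc; toℕ; fromℕ<; combine; remQuot)
open import Data.Fin.Patterns using (0F; 1F; 2F; 3F; 4F; 5F; 6F; 7F)
import Data.Fin.Properties as Fin
import Data.Integer as ℤ
import Data.Integer.Properties as ℤ
open import Data.List
  using (List; []; _∷_; _++_; length; map; concat; cartesianProductWith; allFin; lookup; tabulate; upTo)
open import Data.List.Membership.Propositional using (_∈_; _∉_)
open import Data.List.Membership.Propositional.Properties
  using (∈-concat⁺′; ∈-cartesianProductWith⁺; ∈-allFin; ∈-map⁺; ∈-upTo⁺; ∈-upTo⁻)
open import Data.List.Relation.Unary.All as All using (All; []; _∷_)
import Data.List.Relation.Unary.All.Properties as All
open import Data.List.Relation.Unary.AllPairs using (AllPairs; _∷_; allPairs?)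
open import Data.List.Relation.Unary.Any as Any using (here; there)
open import Data.List.Relation.Unary.Any.Properties using (lookup-index)
open import Data.List.Relation.Unary.Unique.Propositional using (Unique)
import Data.List.Relation.Unary.Unique.DecPropositional as DecUnique
open import Data.List.Relation.Unary.Unique.Propositional.Properties using (upTo⁺)
open import Data.Nat as ℕ using (ℕ)
import Data.Nat.Coprimality as Coprimality
import Data.Nat.Properties as ℕ
open import Data.Product as Product using (_×_; _,_; proj₁; proj₂; ∃-syntax)
open import Data.Product.Properties using (≡-dec)
open import Data.Rational as ℚ using (ℚ; mkℚ; 0ℚ; 1ℚ)
import Data.Rational.Properties as ℚ
import Data.Rational.Solver as ℚSolver
import Data.Rational.Unnormalised as ℚᵘ
import Data.Rational.Unnormalised.Properties as ℚᵘ
open import Data.Sum as Sum using (_⊎_; inj₁; inj₂)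
open import Function using (_∘_)
open import Relation.Binary.Definitions using (Decidable; Symmetric)
open import Relation.Binary.PropositionalEquality
  using (_≡_; _≢_; refl; sym; trans; cong; cong₂; subst; ≢-sym)
open import Relation.Nullary using (¬_; Dec; contradiction)
open import Relation.Nullary.Decidable using (toWitness; decidable-stable; _×-dec_; _⊎-dec_)

-- Pairwise relations in tabulated lists.

-- `AllPairs` relates an entry only to later ones; symmetry supplies the other order.
allPairs-tabulate⁻ : ∀ {A : Set} {R : A → A → Set} {n} {f : Fin n → A} → Symmetric R →
  AllPairs R (tabulate f) → ∀ {i j} → i ≢ j → R (f i) (f j)
allPairs-tabulate⁻ R-sym (r ∷ rs) {zero}  {zero}  i≢j = contradiction refl i≢j
allPairs-tabulate⁻ R-sym (r ∷ rs) {zero}  {suc j} i≢j = All.tabulate⁻ r j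
allPairs-tabulate⁻ R-sym (r ∷ rs) {suc i} {zero}  i≢j = R-sym (All.tabulate⁻ r i)
allPairs-tabulate⁻ R-sym (r ∷ rs) {suc i} {suc j} i≢j = allPairs-tabulate⁻ R-sym rs (i≢j ∘ cong suc)

unique-tabulate⇒injective : ∀ {A : Set} {n} {f : Fin n → A} →
  Unique (tabulate f) → ∀ {i j} → f i ≡ f j → i ≡ j
unique-tabulate⇒injective unique {i} {j} fi≡fj = decidable-stable (i Fin.≟ j)
  λ i≢j → allPairs-tabulate⁻ ≢-sym unique i≢j fi≡fj

-- Straight-line drawings on the natural grid

-- Built in lowest terms directly, so that numerator and denominator are visible by computation.
fromℕ : ℕ → ℚ
fromℕ n = mkℚ (ℤ.+ n) 0 (Coprimality.sym (Coprimality.1-coprimeTo n))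

fromℕ-injective : ∀ {m n} → fromℕ m ≡ fromℕ n → m ≡ n
fromℕ-injective = ℤ.+-injective ∘ cong ℚ.↥_

fromℕ-+ : ∀ m n → fromℕ (m ℕ.+ n) ≡ fromℕ m ℚ.+ fromℕ n
fromℕ-+ m n = ℚ.toℚᵘ-injective (ℚᵘ.≃-trans
  (ℚᵘ.*≡* (cong (ℤ._* ℤ.1ℤ) (trans (ℤ.pos-+ m n)
    (sym (cong₂ ℤ._+_ (ℤ.*-identityʳ (ℤ.+ m)) (ℤ.*-identityʳ (ℤ.+ n)))))))
  (ℚᵘ.≃-sym (ℚ.toℚᵘ-homo-+ (fromℕ m) (fromℕ n))))

fromℕ-* : ∀ m n → fromℕ (m ℕ.* n) ≡ fromℕ m ℚ.* fromℕ n
fromℕ-* m n = ℚ.toℚᵘ-injective (ℚᵘ.≃-trans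
  (ℚᵘ.*≡* (cong (ℤ._* ℤ.1ℤ) (ℤ.pos-* m n)))
  (ℚᵘ.≃-sym (ℚ.toℚᵘ-homo-* (fromℕ m) (fromℕ n))))

fromℕ-mono-≤ : ∀ {m n} → m ℕ.≤ n → fromℕ m ℚ.≤ fromℕ n
fromℕ-mono-≤ m≤n = ℚ.*≤* (ℤ.*-monoʳ-≤-nonNeg ℤ.1ℤ (ℤ.+≤+ m≤n))

fromℕ-mono-< : ∀ {m n} → m ℕ.< n → fromℕ m ℚ.< fromℕ n
fromℕ-mono-< m<n = ℚ.*<* (ℤ.*-monoʳ-<-pos ℤ.1ℤ (ℤ.+<+ m<n))

-- Twice the signed area of the triangle a b c is Σ (aₓbᵧ − aᵧbₓ), the sum
-- running over the cyclic shifts of a, b, c.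
area : Point → Point → Point → ℚ
area (ax , ay) (bx , by) (cx , cy) =
  (ax ℚ.* by ℚ.+ bx ℚ.* cy ℚ.+ cx ℚ.* ay) ℚ.- (ay ℚ.* bx ℚ.+ by ℚ.* cx ℚ.+ cy ℚ.* ax)

module _ where
  open ℚSolver.+-*-Solver

  onSegment-reverse : ∀ {p} a b → OnSegment p a b → OnSegment p b a
  onSegment-reverse (ax , ay) (bx , by) (t , 0≤t , t≤1 , px≡ , py≡) =
    1ℚ ℚ.- t ,
    subst (ℚ._≤ 1ℚ ℚ.- t) (ℚ.+-inverseʳ t) (ℚ.+-monoˡ-≤ (ℚ.- t) t≤1) ,
    subst (1ℚ ℚ.- t ℚ.≤_) (ℚ.+-identityʳ 1ℚ) (ℚ.+-monoʳ-≤ 1ℚ (ℚ.neg-antimono-≤ 0≤t)) ,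
    trans px≡ (flip ax bx) , trans py≡ (flip ay by)
    where
    flip : ∀ x y → x ℚ.+ t ℚ.* (y ℚ.- x) ≡ y ℚ.+ (1ℚ ℚ.- t) ℚ.* (x ℚ.- y)
    flip x y = solve 3 (λ x y t → x :+ t :* (y :- x) := y :+ (con 1ℚ :- t) :* (x :- y)) refl x y t

  -- The signed area is an affine function of its third vertex.
  area-along : ∀ a b c d {p} ((t , _) : OnSegment p c d) →
    area a b p ≡ area a b c ℚ.+ t ℚ.* (area a b d ℚ.- area a b c)
  area-along (ax , ay) (bx , by) (cx , cy) (dx , dy) (t , _ , _ , refl , refl) =
    solve 9 (λ ax ay bx by cx cy dx dy t →
      let A = λ px py → (ax :* by :+ bx :* py :+ px :* ay) :- (ay :* bx :+ by :* px :+ py :* ax) in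
      A (cx :+ t :* (dx :- cx)) (cy :+ t :* (dy :- cy))
        := A cx cy :+ t :* (A dx dy :- A cx cy))
      refl ax ay bx by cx cy dx dy t

  area-source : ∀ a b → area a b a ≡ 0ℚ
  area-source (ax , ay) (bx , by) =
    solve 4 (λ ax ay bx by →
      (ax :* by :+ bx :* ay :+ ax :* ay) :- (ay :* bx :+ by :* ax :+ ay :* ax) := con 0ℚ)
      refl ax ay bx by

  area-target : ∀ a b → area a b b ≡ 0ℚ
  area-target (ax , ay) (bx , by) =
    solve 4 (λ ax ay bx by →
      (ax :* by :+ bx :* by :+ bx :* ay) :- (ay :* bx :+ by :* bx :+ by :* ax) := con 0ℚ)
      refl ax ay bx by

  convex-combination : ∀ x y t → x ℚ.+ t ℚ.* (y ℚ.- x) ≡ (1ℚ ℚ.- t) ℚ.* x ℚ.+ y ℚ.* t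
  convex-combination =
    solve 3 (λ x y t → x :+ t :* (y :- x) := (con 1ℚ :- t) :* x :+ y :* t) refl

onSegment⇒area≡0 : ∀ a b {p} → OnSegment p a b → area a b p ≡ 0ℚ
onSegment⇒area≡0 a b on@(t , _) = trans (area-along a b a b on)
  (trans (cong₂ (λ x y → x ℚ.+ t ℚ.* (y ℚ.- x)) (area-source a b) (area-target a b))
    (trans (ℚ.+-identityˡ _) (ℚ.*-zeroʳ t)))

p≤q⇒0≤q-p : ∀ {p q} → p ℚ.≤ q → 0ℚ ℚ.≤ q ℚ.- p
p≤q⇒0≤q-p {p} {q} p≤q = subst (ℚ._≤ q ℚ.- p) (ℚ.+-inverseʳ p) (ℚ.+-monoˡ-≤ (ℚ.- p) p≤q)

p<q⇒0<q-p : ∀ {p q} → p ℚ.< q → 0ℚ ℚ.< q ℚ.- p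
p<q⇒0<q-p {p} {q} p<q = subst (ℚ._< q ℚ.- p) (ℚ.+-inverseʳ p) (ℚ.+-monoˡ-< (ℚ.- p) p<q)

-- The left side of the equation is (1 - t)x + ty, a sum of nonnegative terms; if it vanishes then
-- ty ≤ 0, and y > 0 leaves only t = 0.
vanishing-combination : ∀ {x y t} → 0ℚ ℚ.≤ x → 0ℚ ℚ.< y → 0ℚ ℚ.≤ t → t ℚ.≤ 1ℚ →
  x ℚ.+ t ℚ.* (y ℚ.- x) ≡ 0ℚ → t ≡ 0ℚ
vanishing-combination {x} {y} {t} 0≤x 0<y 0≤t t≤1 eq =
  ℚ.≤-antisym (ℚ.*-cancelˡ-≤-pos y {{ℚ.positive 0<y}} yt≤y0) 0≤t
  where
  open ℚ.≤-Reasoning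
  0≤1-t*x : 0ℚ ℚ.≤ (1ℚ ℚ.- t) ℚ.* x
  0≤1-t*x = ℚ.nonNegative⁻¹ _ {{ℚ.nonNeg*nonNeg⇒nonNeg (1ℚ ℚ.- t)
    {{ℚ.nonNegative (p≤q⇒0≤q-p t≤1)}} x {{ℚ.nonNegative 0≤x}}}}
  yt≤y0 : y ℚ.* t ℚ.≤ y ℚ.* 0ℚ
  yt≤y0 = begin
    y ℚ.* t                          ≡⟨ ℚ.+-identityˡ (y ℚ.* t) ⟨
    0ℚ ℚ.+ y ℚ.* t                   ≤⟨ ℚ.+-monoˡ-≤ (y ℚ.* t) 0≤1-t*x ⟩
    (1ℚ ℚ.- t) ℚ.* x ℚ.+ y ℚ.* t     ≡⟨ convex-combination x y t ⟨
    x ℚ.+ t ℚ.* (y ℚ.- x)            ≡⟨ eq ⟩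
    0ℚ                               ≡⟨ ℚ.*-zeroʳ y ⟨
    y ℚ.* 0ℚ                         ∎

-- Relative to the line `a b`, the area is 0 at `p`, nonnegative at `c` and positive at `d`. Being
-- affine along `c d`, it vanishes only at parameter 0, which is `c`.
meet-at-source : ∀ a b c d {p} → 0ℚ ℚ.≤ area a b c → 0ℚ ℚ.< area a b d →
  OnSegment p a b → OnSegment p c d → p ≡ c
meet-at-source a b c@(cx , cy) d@(dx , dy) {px , py} 0≤ 0< on-ab on-cd@(t , 0≤t , t≤1 , px≡ , py≡) =
  cong₂ _,_ (trans px≡ (at-source cx dx)) (trans py≡ (at-source cy dy))
  where
  t≡0 : t ≡ 0ℚ
  t≡0 = vanishing-combination 0≤ 0< 0≤t t≤1
    (trans (sym (area-along a b c d on-cd)) (onSegment⇒area≡0 a b on-ab))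
  at-source : ∀ x y → x ℚ.+ t ℚ.* (y ℚ.- x) ≡ x
  at-source x y = trans (cong (λ s → x ℚ.+ s ℚ.* (y ℚ.- x)) t≡0)
    (trans (cong (x ℚ.+_) (ℚ.*-zeroˡ (y ℚ.- x))) (ℚ.+-identityʳ x))

GridPoint GridSegment : Set
GridPoint   = ℕ × ℕ
GridSegment = GridPoint × GridPoint

toPoint : GridPoint → Point
toPoint (x , y) = fromℕ x , fromℕ y

toPoint-injective : ∀ {p q} → toPoint p ≡ toPoint q → p ≡ q
toPoint-injective eq = cong₂ _,_ (fromℕ-injective (cong proj₁ eq)) (fromℕ-injective (cong proj₂ eq))

-- The positive and the negative part of area, so that its sign can be read off
-- in ℕ.
area⁺ area⁻ : GridPoint → GridPoint → GridPoint → ℕ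
area⁺ (ax , ay) (bx , by) (cx , cy) = ax ℕ.* by ℕ.+ bx ℕ.* cy ℕ.+ cx ℕ.* ay
area⁻ (ax , ay) (bx , by) (cx , cy) = ay ℕ.* bx ℕ.+ by ℕ.* cx ℕ.+ cy ℕ.* ax

fromℕ-sum-of-products : ∀ a b c d e f →
  fromℕ (a ℕ.* b ℕ.+ c ℕ.* d ℕ.+ e ℕ.* f) ≡
  fromℕ a ℚ.* fromℕ b ℚ.+ fromℕ c ℚ.* fromℕ d ℚ.+ fromℕ e ℚ.* fromℕ f
fromℕ-sum-of-products a b c d e f =
  trans (fromℕ-+ (a ℕ.* b ℕ.+ c ℕ.* d) (e ℕ.* f)) (cong₂ ℚ._+_
    (trans (fromℕ-+ (a ℕ.* b) (c ℕ.* d)) (cong₂ ℚ._+_ (fromℕ-* a b) (fromℕ-* c d)))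
    (fromℕ-* e f))

area-toPoint : ∀ a b c →
  area (toPoint a) (toPoint b) (toPoint c) ≡ fromℕ (area⁺ a b c) ℚ.- fromℕ (area⁻ a b c)
area-toPoint (ax , ay) (bx , by) (cx , cy) = sym (cong₂ ℚ._-_
  (fromℕ-sum-of-products ax by bx cy cx ay) (fromℕ-sum-of-products ay bx by cx cy ax))

-- Exchanging `a` and `b` changes the sign of the area, so the same relations with `b a` describe
-- the other side of the line.
Left WeaklyLeft : GridPoint → GridPoint → GridPoint → Set
Left       a b c = area⁻ a b c ℕ.< area⁺ a b c
WeaklyLeft a b c = area⁻ a b c ℕ.≤ area⁺ a b c

left⇒0<area : ∀ a b c → Left a b c → 0ℚ ℚ.< area (toPoint a) (toPoint b) (toPoint c)
left⇒0<area a b c l = subst (0ℚ ℚ.<_) (sym (area-toPoint a b c)) (p<q⇒0<q-p (fromℕ-mono-< l))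

weaklyLeft⇒0≤area : ∀ a b c → WeaklyLeft a b c → 0ℚ ℚ.≤ area (toPoint a) (toPoint b) (toPoint c)
weaklyLeft⇒0≤area a b c l = subst (0ℚ ℚ.≤_) (sym (area-toPoint a b c)) (p≤q⇒0≤q-p (fromℕ-mono-≤ l))

left⇒notOnSegment : ∀ a b c → Left a b c → ¬ OnSegment (toPoint c) (toPoint a) (toPoint b)
left⇒notOnSegment a b c l on =
  ℚ.<⇒≢ (left⇒0<area a b c l) (sym (onSegment⇒area≡0 (toPoint a) (toPoint b) on))

Beside : GridPoint → GridPoint → GridPoint → GridPoint → Set
Beside a b c d = WeaklyLeft a b c × Left a b d

-- One closed side of the line a b contains c and d, and c and d are not both on
-- the line.
OneSide : GridSegment → GridSegment → Set
OneSide (a , b) (c , d) = Beside a b c d ⊎ Beside a b d c ⊎ Beside b a c d ⊎ Beside b a d c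

beside⇒meet-at-source : ∀ a b c d {p} → Beside a b c d →
  OnSegment p (toPoint a) (toPoint b) → OnSegment p (toPoint c) (toPoint d) → p ≡ toPoint c
beside⇒meet-at-source a b c d (wl , l) =
  meet-at-source (toPoint a) (toPoint b) (toPoint c) (toPoint d)
    (weaklyLeft⇒0≤area a b c wl) (left⇒0<area a b d l)

oneSide⇒meet-at-end : ∀ {a b c d p} → OneSide (a , b) (c , d) →
  OnSegment p (toPoint a) (toPoint b) → OnSegment p (toPoint c) (toPoint d) →
  p ≡ toPoint c ⊎ p ≡ toPoint d
oneSide⇒meet-at-end {a} {b} {c} {d} side ab cd with side
... | inj₁ s               = inj₁ (beside⇒meet-at-source a b c d s ab cd)
... | inj₂ (inj₁ s)        = inj₂ (beside⇒meet-at-source a b d c s ab dc)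
  where dc = onSegment-reverse (toPoint c) (toPoint d) cd
... | inj₂ (inj₂ (inj₁ s)) = inj₁ (beside⇒meet-at-source b a c d s ba cd)
  where ba = onSegment-reverse (toPoint a) (toPoint b) ab
... | inj₂ (inj₂ (inj₂ s)) = inj₂ (beside⇒meet-at-source b a d c s ba dc)
  where
  ba = onSegment-reverse (toPoint a) (toPoint b) ab
  dc = onSegment-reverse (toPoint c) (toPoint d) cd

-- Both directions are offered because, of two disjoint segments, one may straddle the line through
-- the other.
Separated : GridSegment → GridSegment → Set
Separated s s′ = OneSide s s′ ⊎ OneSide s′ s

Avoids : GridSegment → GridPoint → Set
Avoids (a , b) c = c ≡ a ⊎ c ≡ b ⊎ Left a b c ⊎ Left b a c

left? : ∀ a b c → Dec (Left a b c)
left? a b c = area⁻ a b c ℕ.<? area⁺ a b c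

beside? : ∀ a b c d → Dec (Beside a b c d)
beside? a b c d = (area⁻ a b c ℕ.≤? area⁺ a b c) ×-dec left? a b d

oneSide? : Decidable OneSide
oneSide? (a , b) (c , d) =
  beside? a b c d ⊎-dec beside? a b d c ⊎-dec beside? b a c d ⊎-dec beside? b a d c

separated? : Decidable Separated
separated? s s′ = oneSide? s s′ ⊎-dec oneSide? s′ s

_≟ᴳ_ : Decidable {A = GridPoint} _≡_
_≟ᴳ_ = ≡-dec ℕ._≟_ ℕ._≟_

avoids? : Decidable Avoids
avoids? (a , b) c = (c ≟ᴳ a) ⊎-dec (c ≟ᴳ b) ⊎-dec left? a b c ⊎-dec left? b a c

AllAvoid : List GridSegment → List GridPoint → Set
AllAvoid segments points = All (λ s → All (Avoids s) points) segments

allAvoid? : Decidable AllAvoid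
allAvoid? segments points = All.all? (λ s → All.all? (avoids? s) points) segments

module _ (G : Graph) (place : Graph.Vertex G → GridPoint) where
  open Graph G

  segment : Edge → GridSegment
  segment e = place (src e) , place (tgt e)

  -- Without corners each arc is one segment, so planarity reduces to three finite conditions,
  -- stated on lists to be decided by computation.
  straightLineDrawing :
    Unique (tabulate place) →
    AllAvoid (tabulate segment) (tabulate place) →
    AllPairs Separated (tabulate segment) →
    PlaneDrawing G
  straightLineDrawing unique avoiding separated = record
    { position           = position
    ; position-injective = position-injective
    ; corners            = λ _ → []
    ; arcs-simple        = λ e eq → Fin.<⇒≢ (ends-ordered e) (position-injective eq)
    ; avoids-vertices    = avoids-vertices
    ; avoids-edges       = avoids-edges
    }
    where
    position : Vertex → Point
    position = toPoint ∘ place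

    position-injective : ∀ {v w} → position v ≡ position w → v ≡ w
    position-injective = unique-tabulate⇒injective unique ∘ toPoint-injective

    On Interior : Point → Edge → Set
    On p e = OnSegment p (position (src e)) (position (tgt e))
    Interior p e = On p e × p ≢ position (src e) × p ≢ position (tgt e)

    avoids-vertices : ∀ e v p → Interior p e → p ≢ position v
    avoids-vertices e v p (on , ≢src , ≢tgt) refl
      with All.tabulate⁻ (All.tabulate⁻ avoiding e) v
    ... | inj₁ eq               = ≢src (cong toPoint eq)
    ... | inj₂ (inj₁ eq)        = ≢tgt (cong toPoint eq)
    ... | inj₂ (inj₂ (inj₁ l))  = left⇒notOnSegment (place (src e)) (place (tgt e)) (place v) l on
    ... | inj₂ (inj₂ (inj₂ l))  = left⇒notOnSegment (place (tgt e)) (place (src e)) (place v) l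
                                    (onSegment-reverse (position (src e)) (position (tgt e)) on)

    avoids-edges : ∀ e f p → e ≢ f → Interior p e → ¬ On p f
    avoids-edges e f p e≢f int@(on-e , ≢src , ≢tgt) on-f
      with allPairs-tabulate⁻ Sum.swap separated e≢f
    -- The common point is an end of `f`, a vertex that the interior of `e` avoids; in the other
    -- case it is an end of `e` itself.
    ... | inj₁ side = Sum.[ avoids-vertices e (src f) p int , avoids-vertices e (tgt f) p int ]
                        (oneSide⇒meet-at-end side on-e on-f)
    ... | inj₂ side = Sum.[ ≢src , ≢tgt ] (oneSide⇒meet-at-end side on-f on-e)

-- Gadgets and the obstruction to colouring

Matching : Set
Matching = List (Fin 4 × Fin 4)

Link : Set → Set
Link V = (V × V) × Matching

equalOn23 : Matching
equalOn23 = (2F , 2F) ∷ (3F , 3F) ∷ []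

-- Nine of the twelve edges; `gadget` lists the three of the outer triangle. Each inner vertex has
-- two outer neighbours, one excluding colour 0 and the other colour 1.
octahedron : ∀ {V : Set} → V → V → V → V → V → V → Fin 4 → Fin 4 → Fin 4 → List (Link V)
octahedron pole w₁ w₂ x y z c d₁ d₂ =
  ((pole , x) , (c  , 0F) ∷ []) ∷ ((w₁ , x) , (d₁ , 1F) ∷ []) ∷
  ((w₁   , y) , (d₁ , 0F) ∷ []) ∷ ((w₂ , y) , (d₂ , 1F) ∷ []) ∷
  ((pole , z) , (c  , 0F) ∷ []) ∷ ((w₂ , z) , (d₂ , 1F) ∷ []) ∷
  ((x , y) , equalOn23) ∷ ((x , z) , equalOn23) ∷ ((y , z) , equalOn23) ∷ []

-- With the poles numbered before the inner nodes, every link names its smaller end first, as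
-- `Graph` demands.
gadget : ∀ {V : Set} → V → V → (Fin 8 → V) → Fin 4 → Fin 4 → List (Link V)
gadget u v inner a b =
  ((u , w₁) , (a , 0F) ∷ []) ∷ ((u , w₂) , (a , 0F) ∷ []) ∷
  ((v , w₁) , (b , 1F) ∷ []) ∷ ((v , w₂) , (b , 1F) ∷ []) ∷
  ((w₁ , w₂) , equalOn23) ∷
  octahedron u w₁ w₂ (inner 2F) (inner 3F) (inner 4F) a 2F 3F ++
  octahedron v w₁ w₂ (inner 5F) (inner 6F) (inner 7F) b 3F 2F
  where
  w₁ = inner 0F
  w₂ = inner 1F

Respects : ∀ {V : Set} → (V → Fin 4) → Link V → Set
Respects χ ((s , t) , m) = (χ s , χ t) ∉ m

module _ {V : Set} (χ : V → Fin 4) where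

  avoids-partner : ∀ {s t c d} → Respects χ ((s , t) , (c , d) ∷ []) → χ s ≡ c → χ t ≢ d
  avoids-partner respects refl refl = respects (here refl)

  Is23 : V → Set
  Is23 v = χ v ≡ 2F ⊎ χ v ≡ 3F

  is23 : ∀ {v} → χ v ≢ 0F → χ v ≢ 1F → Is23 v
  is23 {v} ≢0 ≢1 with χ v
  ... | 0F = contradiction refl ≢0
  ... | 1F = contradiction refl ≢1
  ... | 2F = inj₁ refl
  ... | 3F = inj₂ refl

  opposite : ∀ {s t} → Respects χ ((s , t) , equalOn23) → Is23 s → Is23 t →
    (χ s ≡ 2F × χ t ≡ 3F) ⊎ (χ s ≡ 3F × χ t ≡ 2F)
  opposite r (inj₁ s≡2) (inj₁ t≡2) = contradiction (here (cong₂ _,_ s≡2 t≡2)) r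
  opposite r (inj₁ s≡2) (inj₂ t≡3) = inj₁ (s≡2 , t≡3)
  opposite r (inj₂ s≡3) (inj₁ t≡2) = inj₂ (s≡3 , t≡2)
  opposite r (inj₂ s≡3) (inj₂ t≡3) = contradiction (there (here (cong₂ _,_ s≡3 t≡3))) r

  -- A triangle has no proper 2-colouring: `y` and `z` both differ from `x`, hence agree.
  no-opposite-triangle : ∀ {x y z} → Respects χ ((x , y) , equalOn23) →
    Respects χ ((x , z) , equalOn23) → Respects χ ((y , z) , equalOn23) →
    Is23 x → Is23 y → Is23 z → ⊥
  no-opposite-triangle xy xz yz x y z with opposite xy x y | opposite xz x z
  ... | inj₁ (_ , y≡3)  | inj₁ (_ , z≡3)  = yz (there (here (cong₂ _,_ y≡3 z≡3)))
  ... | inj₁ (x≡2 , _)  | inj₂ (x≡3 , _)  = contradiction (trans (sym x≡2) x≡3) λ ()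
  ... | inj₂ (x≡3 , _)  | inj₁ (x≡2 , _)  = contradiction (trans (sym x≡2) x≡3) λ ()
  ... | inj₂ (_ , y≡2)  | inj₂ (_ , z≡2)  = yz (here (cong₂ _,_ y≡2 z≡2))

  octahedron-obstructs : ∀ {pole w₁ w₂ x y z c d₁ d₂} →
    All (Respects χ) (octahedron pole w₁ w₂ x y z c d₁ d₂) →
    χ pole ≡ c → χ w₁ ≡ d₁ → χ w₂ ≡ d₂ → ⊥
  octahedron-obstructs (px ∷ w₁x ∷ w₁y ∷ w₂y ∷ pz ∷ w₂z ∷ xy ∷ xz ∷ yz ∷ []) p≡c w₁≡d₁ w₂≡d₂ =
    no-opposite-triangle xy xz yz
      (is23 (avoids-partner px p≡c) (avoids-partner w₁x w₁≡d₁))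
      (is23 (avoids-partner w₁y w₁≡d₁) (avoids-partner w₂y w₂≡d₂))
      (is23 (avoids-partner pz p≡c) (avoids-partner w₂z w₂≡d₂))

  gadget-obstructs : ∀ {u v inner a b} → All (Respects χ) (gadget u v inner a b) →
    χ u ≡ a → χ v ≡ b → ⊥
  gadget-obstructs (uw₁ ∷ uw₂ ∷ vw₁ ∷ vw₂ ∷ w₁w₂ ∷ octahedra) u≡a v≡b
    with opposite w₁w₂ (is23 (avoids-partner uw₁ u≡a) (avoids-partner vw₁ v≡b))
                       (is23 (avoids-partner uw₂ u≡a) (avoids-partner vw₂ v≡b))
       | All.++⁻ (octahedron _ _ _ _ _ _ _ _ _) octahedra
  ... | inj₁ (w₁≡2 , w₂≡3) | at-u , _ = octahedron-obstructs at-u u≡a w₁≡2 w₂≡3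
  ... | inj₂ (w₁≡3 , w₂≡2) | _ , at-v = octahedron-obstructs at-v v≡b w₁≡3 w₂≡2

-- Graphs and assignments from lists of links.

module LinkedGraph {n} (links : List (Link (Fin n))) where

  linkEnds : Fin (length links) → Fin n × Fin n
  linkEnds = proj₁ ∘ lookup links

  colourPairs : Fin (length links) → List (Colour × Colour)
  colourPairs = map (Product.map toℕ toℕ) ∘ proj₂ ∘ lookup links

  Ordered Distinct UniqueLeft UniqueRight Small : Set
  Ordered     = All (λ (s , t) → s Fin.< t) (tabulate linkEnds)
  Distinct    = Unique (tabulate (Product.map toℕ toℕ ∘ linkEnds))
  UniqueLeft  = All (Unique ∘ map proj₁) (tabulate colourPairs)
  UniqueRight = All (Unique ∘ map proj₂) (tabulate colourPairs)
  Small       = All (λ m → length m ℕ.≤ 2) (tabulate colourPairs)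

  ordered? : Dec Ordered
  ordered? = All.all? (λ (s , t) → s Fin.<? t) (tabulate linkEnds)

  distinct? : Dec Distinct
  distinct? = DecUnique.unique? _≟ᴳ_ (tabulate (Product.map toℕ toℕ ∘ linkEnds))

  uniqueLeft? : Dec UniqueLeft
  uniqueLeft? = All.all? (DecUnique.unique? ℕ._≟_ ∘ map proj₁) (tabulate colourPairs)

  uniqueRight? : Dec UniqueRight
  uniqueRight? = All.all? (DecUnique.unique? ℕ._≟_ ∘ map proj₂) (tabulate colourPairs)

  small? : Dec Small
  small? = All.all? (λ m → length m ℕ.≤? 2) (tabulate colourPairs)

  module _ (ordered : Ordered) (distinct : Distinct) where

    graph : Graph
    graph = record
      { order          = n
      ; size           = length links
      ; ends           = linkEnds
      ; ends-ordered   = All.tabulate⁻ ordered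
      ; ends-injective = unique-tabulate⇒injective distinct ∘ cong (Product.map toℕ toℕ)
      }

    module _ (uniqueLeft : UniqueLeft) (uniqueRight : UniqueRight) where

      assignment : CorrespondenceAssignment graph
      assignment = record
        { L         = λ _ → upTo 4
        ; L-unique  = λ _ → upTo⁺ 4
        ; M         = colourPairs
        ; M-lists   = λ e → All.map⁺ (All.universal (λ (c , d) →
                        ∈-upTo⁺ (Fin.toℕ<n c) , ∈-upTo⁺ (Fin.toℕ<n d)) (proj₂ (lookup links e)))
        ; M-uniqueˡ = All.tabulate⁻ uniqueLeft
        ; M-uniqueʳ = All.tabulate⁻ uniqueRight
        }

      assignment-4-2 : Small → Is⟨ 4 , 2 ⟩-Assignment assignment
      assignment-4-2 small = (λ _ → ℕ.≤-refl) , All.tabulate⁻ small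

      -- All lists are `upTo 4`, so a colouring takes values below 4 and can be read in `Fin 4`,
      -- where the obstruction is a finite case analysis.
      colourable⇒respected : Colourable assignment → ∃[ χ ] All (Respects χ) links
      colourable⇒respected (φ , φ∈L , φ∉M) = χ , All.tabulate λ ∈links →
        subst (Respects χ) (sym (lookup-index ∈links)) (respects (Any.index ∈links))
        where
        χ : Fin n → Fin 4
        χ v = fromℕ< (∈-upTo⁻ (φ∈L v))
        toℕ-χ : ∀ v → toℕ (χ v) ≡ φ v
        toℕ-χ v = Fin.toℕ-fromℕ< (∈-upTo⁻ (φ∈L v))
        respects : ∀ e → Respects χ (lookup links e)
        respects e χ∈m = φ∉M e (subst (_∈ colourPairs e)
          (cong₂ _,_ (toℕ-χ (proj₁ (linkEnds e))) (toℕ-χ (proj₂ (linkEnds e))))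
          (∈-map⁺ (Product.map toℕ toℕ) χ∈m))

      not-4-2-choosable : Small → (∀ χ → ¬ All (Respects χ) links) → ¬ CorrespondenceChoosable 4 2 graph
      not-4-2-choosable small obstructed choosable =
        Product.uncurry obstructed (colourable⇒respected (choosable assignment (assignment-4-2 small)))

    module _ (place : Fin n → GridPoint) where

      planar : Unique (tabulate place) →
        AllAvoid (tabulate (Product.map place place ∘ linkEnds)) (tabulate place) →
        AllPairs Separated (tabulate (Product.map place place ∘ linkEnds)) →
        Planar graph
      planar = straightLineDrawing graph place

-- The graph of sixteen gadgets.

-- Two poles, then a block of eight inner nodes for each pair of pole colours.
Node : Set
Node = Fin (2 ℕ.+ (4 ℕ.* 4) ℕ.* 8)

innerNode : Fin 4 → Fin 4 → Fin 8 → Node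
innerNode a b r = suc (suc (combine (combine a b) r))

gadgetAt : Fin 4 → Fin 4 → List (Link Node)
gadgetAt a b = gadget 0F 1F (innerNode a b) a b

links : List (Link Node)
links = concat (cartesianProductWith gadgetAt (allFin 4) (allFin 4))

-- The colours that `χ` gives to the poles select the gadget that it cannot respect.
links-obstructed : ∀ χ → ¬ All (Respects χ) links
links-obstructed χ respected =
  gadget-obstructs χ {inner = innerNode (χ 0F) (χ 1F)} (All.tabulate respects-link) refl refl
  where
  respects-link : ∀ {l} → l ∈ gadgetAt (χ 0F) (χ 1F) → Respects χ l
  respects-link l∈gadget = All.lookup respected
    (∈-concat⁺′ l∈gadget (∈-cartesianProductWith⁺ gadgetAt (∈-allFin (χ 0F)) (∈-allFin (χ 1F))))

-- The drawing of the sixteen gadgets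

-- The poles lie on either side of the 32 hubs and just above the highest, at 50 * 31 = 1550. Both
-- see the hubs in order of index, so the paths from pole to pole through single hubs are nested,
-- and each gadget fills the strip between two consecutive paths.
pole : Fin 2 → GridPoint
pole 0F = 0 , 1551
pole 1F = 3000 , 1551

-- Points of a parabola, so that no three of them are collinear, as Avoids concerns
-- the whole line through an edge.
hub : ℕ → GridPoint
hub j = 100 ℕ.+ j ℕ.* j , 50 ℕ.* j

-- Barycentric coordinates scaled by 5: the weights always have sum 5, and so all
-- points are integral.
weighted : GridPoint → GridPoint → GridPoint → ℕ → ℕ → ℕ → GridPoint
weighted (ax , ay) (bx , by) (cx , cy) l m n =
  l ℕ.* ax ℕ.+ m ℕ.* bx ℕ.+ n ℕ.* cx , l ℕ.* ay ℕ.+ m ℕ.* by ℕ.+ n ℕ.* cy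

placeInner : Fin (4 ℕ.* 4) → Fin 8 → GridPoint
placeInner k = role
  where
  inTriangle : Fin 2 → ℕ → ℕ → ℕ → GridPoint
  inTriangle p = weighted (pole p) (hub (2 ℕ.* toℕ k)) (hub (1 ℕ.+ 2 ℕ.* toℕ k))
  role : Fin 8 → GridPoint
  role 0F = inTriangle 0F 0 5 0
  role 1F = inTriangle 0F 0 0 5
  -- An inner vertex has weight 2 at its two outer neighbours and 1 at the third corner, so `x y z`
  -- is an inverted triangle inside the outer one.
  role 2F = inTriangle 0F 2 2 1
  role 3F = inTriangle 0F 1 2 2
  role 4F = inTriangle 0F 2 1 2
  role 5F = inTriangle 1F 2 2 1
  role 6F = inTriangle 1F 1 2 2
  role 7F = inTriangle 1F 2 1 2

place : Node → GridPoint
-- The full weight 5 on one corner brings the pole to the common scale.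
place 0F            = weighted (pole 0F) (hub 0) (hub 1) 5 0 0
place 1F            = weighted (pole 1F) (hub 0) (hub 1) 5 0 0
place (suc (suc i)) = Product.uncurry placeInner (remQuot {4 ℕ.* 4} 8 i)

-- Verification of the finite conditions by computation.

open LinkedGraph links

ordered : Ordered
ordered = toWitness {a? = ordered?} _

distinct : Distinct
distinct = toWitness {a? = distinct?} _

uniqueLeft : UniqueLeft
uniqueLeft = toWitness {a? = uniqueLeft?} _

uniqueRight : UniqueRight
uniqueRight = toWitness {a? = uniqueRight?} _

small : Small
small = toWitness {a? = small?} _

points : List GridPoint
points = tabulate place

segments : List GridSegment
segments = tabulate (Product.map place place ∘ linkEnds)

points-unique : Unique points
points-unique = toWitness {a? = DecUnique.unique? _≟ᴳ_ points} _

segments-avoid-points : AllAvoid segments points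
segments-avoid-points = toWitness {a? = allAvoid? segments points} _

segments-separated : AllPairs Separated segments
segments-separated = toWitness {a? = allPairs? separated? segments} _

theorem1p8 : ∃[ G ] (Planar G × ¬ CorrespondenceChoosable 4 2 G)
theorem1p8 =
  graph ordered distinct ,
  planar ordered distinct place points-unique segments-avoid-points segments-separated ,
  not-4-2-choosable ordered distinct uniqueLeft uniqueRight small links-obstructed
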